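{- Let $n$, $k$ and $r$ be positive integers. Then $$V_k(n) \;=\; \sum_{i=0}^{r-1} Q_{rk}(n+ik) \;=\; Q_{rk}(n)+Q_{rk}(n+k)+\cdots+Q_{rk}(n+(r-1)k).$$
   Context: A partition of a positive integer $m$ is a non-increasing sequence of positive integers (its parts) summing to $m$. For positive integers $j,m$, $Q_j(m)$ denotes the total number of occurrences of the part $j$ among all partitions of $m$ (a partition in which $j$ appears $t$ times contributes $t$). $V_k(m)$ denotes the sum, over all partitions of $m$, of the number of distinct part sizes that occur $k$ or more times in that partition. -}

module Defs where

open import Data.Bool.Base using (true; false; if_then_else_)
open import Data.Empty using (⊥)
open import Data.List.Base using (List; []; _∷_; _++_; map; filter; length; deduplicate)
open import Data.List.Membership.Propositional using (_∈_)
open import Data.List.Membership.Propositional.Properties using (∈-++⁺ˡ; ∈-++⁺ʳ; ∈-++⁻; ∈-map⁺; ∈-map⁻)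
open import Data.List.Properties using (∷-injectiveʳ)
open import Data.List.Relation.Unary.All using (All; []; _∷_)
open import Data.List.Relation.Unary.Any using (here)
open import Data.List.Relation.Unary.Linked using (Linked; []; [-]; _∷_)
open import Data.List.Relation.Unary.Unique.Propositional using (Unique; []; _∷_)
open import Data.List.Relation.Unary.Unique.Propositional.Properties using (map⁺; ++⁺)
open import Data.Nat.Base using (ℕ; zero; suc; _+_; _∸_; _≤_; _<_; _≥_; _≤ᵇ_; s≤s⁻¹; z<s)
open import Data.Nat.ListAction using (sum)
open import Data.Nat.Properties
open import Data.Product.Base using (_×_; _,_)
open import Data.Sum.Base using (inj₁; inj₂)
open import Function.Bundles using (_⇔_; mk⇔)
open import Relation.Binary.PropositionalEquality using (_≡_; refl; sym; trans; cong)
open import Relation.Nullary.Decidable.Core using (yes; no)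
open import Relation.Nullary.Reflects using (ofʸ; ofⁿ)
open import Relation.Nullary.Negation.Core using (contradiction)

record IsPartition (m : ℕ) (π : List ℕ) : Set where
  constructor isPartition
  field
    nonIncreasing : Linked _≥_ π
    positive      : All (0 <_) π
    sum≡          : sum π ≡ m

-- partitionsUpTo f b m lists the partitions of m with all parts ≤ b: those
-- with a part b, followed by those without. The fuel f only serves the
-- termination checker; any f ≥ b + m gives the complete list.
partitionsUpTo : (f b m : ℕ) → List (List ℕ)
partitionsUpTo f       b       zero    = [] ∷ []
partitionsUpTo f       zero    (suc m) = []
partitionsUpTo zero    (suc b) (suc m) = []
partitionsUpTo (suc f) (suc b) (suc m) =
  (if suc b ≤ᵇ suc m
   then map (suc b ∷_) (partitionsUpTo f (suc b) (m ∸ b))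
   else [])
  ++ partitionsUpTo f b (suc m)

-- ∈-partitions⇔ and partitions-unique below show that this list contains
-- each partition of m exactly once, and nothing else.
partitions : ℕ → List (List ℕ)
partitions m = partitionsUpTo (m + m) m m

multiplicity : ℕ → List ℕ → ℕ
multiplicity j π = length (filter (j ≟_) π)

Q : ℕ → ℕ → ℕ
Q j m = sum (map (multiplicity j) (partitions m))

distinctPartsOccurring≥ : ℕ → List ℕ → ℕ
distinctPartsOccurring≥ k π =
  length (filter (λ j → k ≤? multiplicity j π) (deduplicate _≟_ π))

V : ℕ → ℕ → ℕ
V k m = sum (map (distinctPartsOccurring≥ k) (partitions m))

private
  -- Linked _≥_ (b ∷ π) says that π is non-increasing with all parts ≤ b.
  Linked-weaken : ∀ {b c π} → b ≤ c → Linked _≥_ (b ∷ π) → Linked _≥_ (c ∷ π)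
  Linked-weaken b≤c [-]       = [-]
  Linked-weaken b≤c (x≤b ∷ l) = ≤-trans x≤b b≤c ∷ l

  sound : ∀ f b m {π} → π ∈ partitionsUpTo f b m →
          Linked _≥_ (b ∷ π) × All (0 <_) π × sum π ≡ m
  sound f       b       zero    (here refl) = [-] , [] , refl
  sound (suc f) (suc b) (suc m) π∈ with suc b ≤ᵇ suc m | ≤ᵇ-reflects-≤ (suc b) (suc m)
  ... | false | ofⁿ _ with l , p , s ← sound f b (suc m) π∈ =
        Linked-weaken (n≤1+n b) l , p , s
  ... | true | ofʸ b≤m with ∈-++⁻ (map (suc b ∷_) (partitionsUpTo f (suc b) (m ∸ b))) π∈
  ...   | inj₂ π∈ʳ with l , p , s ← sound f b (suc m) π∈ʳ =
          Linked-weaken (n≤1+n b) l , p , s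
  ...   | inj₁ π∈ˡ with ρ , ρ∈ , refl ← ∈-map⁻ (suc b ∷_) π∈ˡ
                   with l , p , s ← sound f (suc b) (m ∸ b) ρ∈ =
          ≤-refl ∷ l , z<s ∷ p ,
          cong suc (trans (cong (b +_) s) (m+[n∸m]≡n (s≤s⁻¹ b≤m)))

  complete : ∀ f b m {π} → b + m ≤ f → Linked _≥_ (b ∷ π) → All (0 <_) π →
             sum π ≡ m → π ∈ partitionsUpTo f b m
  complete f b zero {[]} _ _ _ _ = here refl
  complete f b zero {zero ∷ _} _ _ (() ∷ _) _
  complete f b zero {suc _ ∷ _} _ _ _ ()
  complete f zero (suc m) {_ ∷ _} _ (x≤0 ∷ _) (0<x ∷ _) _ =
    contradiction (<-≤-trans 0<x x≤0) n≮0
  complete (suc f) (suc b) (suc m) {x ∷ π} b+m≤f (x≤b ∷ l) (0<x ∷ p) s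
    with suc b ≤ᵇ suc m | ≤ᵇ-reflects-≤ (suc b) (suc m) | x ≟ suc b
  ... | true | ofʸ b≤m | yes refl =
        ∈-++⁺ˡ (∈-map⁺ (suc b ∷_)
          (complete f (suc b) (m ∸ b) fuel l p
            (trans (sym (m+n∸m≡n b (sum π))) (cong (_∸ b) (suc-injective s)))))
    where
      fuel : suc b + (m ∸ b) ≤ f
      fuel = ≤-trans (≤-trans (≤-reflexive (cong suc (m+[n∸m]≡n (s≤s⁻¹ b≤m))))
                              (m≤n+m (suc m) b))
                     (s≤s⁻¹ b+m≤f)
  ... | true | ofʸ _ | no x≢b =
        ∈-++⁺ʳ _ (complete f b (suc m) (s≤s⁻¹ b+m≤f)
          (s≤s⁻¹ (≤∧≢⇒< x≤b x≢b) ∷ l) (0<x ∷ p) s)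
  ... | false | ofⁿ b≰m | yes refl =
        contradiction (≤-trans (m≤m+n (suc b) (sum π)) (≤-reflexive s)) b≰m
  ... | false | ofⁿ _ | no x≢b =
        complete f b (suc m) (s≤s⁻¹ b+m≤f)
          (s≤s⁻¹ (≤∧≢⇒< x≤b x≢b) ∷ l) (0<x ∷ p) s

  unique : ∀ f b m → Unique (partitionsUpTo f b m)
  unique f       b       zero    = [] ∷ []
  unique f       zero    (suc m) = []
  unique zero    (suc b) (suc m) = []
  unique (suc f) (suc b) (suc m) with suc b ≤ᵇ suc m
  ... | false = unique f b (suc m)
  ... | true  = ++⁺ (map⁺ ∷-injectiveʳ (unique f (suc b) (m ∸ b)))
                    (unique f b (suc m)) disjoint
    where
      disjoint : ∀ {π} → π ∈ map (suc b ∷_) (partitionsUpTo f (suc b) (m ∸ b)) ×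
                 π ∈ partitionsUpTo f b (suc m) → ⊥
      disjoint (π∈ˡ , π∈ʳ)
        with _ , _ , refl ← ∈-map⁻ (suc b ∷_) π∈ˡ
        with b<b ∷ _ , _ ← sound f b (suc m) π∈ʳ = contradiction b<b (n≮n b)

  Linked-sum : ∀ {π} → Linked _≥_ π → Linked _≥_ (sum π ∷ π)
  Linked-sum {[]}    l = [-]
  Linked-sum {x ∷ π} l = m≤m+n x (sum π) ∷ l

  Linked-tail : ∀ {b π} → Linked _≥_ (b ∷ π) → Linked _≥_ π
  Linked-tail [-]     = []
  Linked-tail (_ ∷ l) = l

∈-partitions⇔ : ∀ m {π} → π ∈ partitions m ⇔ IsPartition m π
∈-partitions⇔ m {π} = mk⇔ to from
  where
    to : π ∈ partitions m → IsPartition m π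
    to π∈ with l , p , s ← sound (m + m) m m π∈ = isPartition (Linked-tail l) p s

    from : IsPartition m π → π ∈ partitions m
    from (isPartition l p refl) = complete (m + m) m m ≤-refl (Linked-sum l) p refl

partitions-unique : ∀ m → Unique (partitions m)
partitions-unique m = unique (m + m) m m

{-# OPTIONS --safe #-}

-- Write p(m) for the number of partitions of m. Removing t copies of j shows
-- that p(n ∸ t j) partitions of n have at least t parts equal to j, so that
-- V_k(n) = p(n ∸ k) + p(n ∸ 2k) + ⋯ and Q_j(n + j) = p(n) + Q_j(n). Both sides
-- of the claim therefore vanish for n < k and satisfy X(n + k) = p(n) + X(n),
-- the sum over i telescoping on the right.
module Submission where

open import Defs
open import Data.Nat.Base using (ℕ; NonZero; _+_; _*_)
open import Data.List.Base using (map; upTo)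
open import Data.Nat.ListAction using (sum)
open import Relation.Binary.PropositionalEquality using (_≡_)
open import Algebra.Properties.CommutativeSemigroup using (interchange; x∙yz≈y∙xz)
open import Data.Bool.Base using (true; false; if_then_else_)
open import Data.List.Base using (List; []; _∷_; _++_; filter; length; deduplicate; applyUpTo)
open import Data.List.Membership.Propositional using (_∈_)
open import Data.List.Membership.Propositional.Properties using (∈-filter⁺; ∈-filter⁻; ∈-deduplicate⁺; ∈-deduplicate⁻; ∈-applyUpTo⁺)
open import Data.List.Membership.Propositional.Properties.WithK using (unique∧set⇒bag)
open import Data.List.Properties using (map-++; map-∘; map-cong; map-cong-local; map-applyUpTo; map-upTo; filter-accept; filter-reject)
open import Data.List.Relation.Binary.BagAndSetEquality using (∼bag⇒↭)
open import Data.List.Relation.Binary.Permutation.Propositional.Properties using (↭-length)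
open import Data.List.Relation.Unary.All using (lookup; tabulate)
open import Data.List.Relation.Unary.Any using (here; there)
open import Data.List.Relation.Unary.Unique.DecPropositional.Properties using (deduplicate-!)
open import Data.List.Relation.Unary.Unique.Propositional.Properties using (filter⁺; applyUpTo⁺₁)
open import Data.Nat.Base using (zero; suc; _∸_; _≤_; _<_; _≤ᵇ_; _≤′_; ≤′-refl; ≤′-step; s≤s; s≤s⁻¹; z<s; s<s; s<s⁻¹)
open import Data.Nat.Induction using (<-rec)
open import Data.Nat.ListAction.Properties using (sum-++)
open import Data.Nat.Properties
open import Data.Product.Base using (_,_)
open import Function.Base using (_∘_)
open import Function.Bundles using (mk⇔; Equivalence)
open import Relation.Binary.PropositionalEquality using (_≢_; _≗_; refl; sym; trans; cong; cong₂; subst; module ≡-Reasoning)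
open import Relation.Nullary.Decidable.Core using (does; yes; no)
open import Relation.Nullary.Reflects using (ofʸ; ofⁿ)
open import Relation.Unary using (Decidable)

open ≡-Reasoning

private
  variable
    A : Set

-- Shifts of sequences and linear recurrences

-- Multiplication of the generating function of f by q ^ d.
shift : ℕ → (ℕ → ℕ) → ℕ → ℕ
shift zero    f n       = f n
shift (suc d) f zero    = 0
shift (suc d) f (suc n) = shift d f n

shift-< : ∀ {d n} f → n < d → shift d f n ≡ 0
shift-< {suc d} {zero}  f _   = refl
shift-< {suc d} {suc n} f n<d = shift-< f (s<s⁻¹ n<d)

shift-≤ : ∀ {d n} f → d ≤ n → shift d f n ≡ f (n ∸ d)
shift-≤ {zero}          f _   = refl
shift-≤ {suc d} {suc n} f d≤n = shift-≤ f (s≤s⁻¹ d≤n)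

-- A shift at `n` reads its argument at most at `n`. The bound is what strong induction can supply
-- in `shift-unique`, and what makes sums over partitions with bounded parts agree with unrestricted
-- ones.
shift-cong-≤ : ∀ d {f g} n → (∀ {m} → m ≤ n → f m ≡ g m) → shift d f n ≡ shift d g n
shift-cong-≤ zero    n       f≡g = f≡g ≤-refl
shift-cong-≤ (suc d) zero    f≡g = refl
shift-cong-≤ (suc d) (suc n) f≡g = shift-cong-≤ d n (f≡g ∘ m≤n⇒m≤1+n)

shift-cong : ∀ d {f g} → f ≗ g → shift d f ≗ shift d g
shift-cong d f≗g n = shift-cong-≤ d n (λ {m} _ → f≗g m)

shift-+ : ∀ d f g n → shift d (λ m → f m + g m) n ≡ shift d f n + shift d g n
shift-+ zero    f g n       = refl
shift-+ (suc d) f g zero    = refl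
shift-+ (suc d) f g (suc n) = shift-+ d f g n

shift-shift : ∀ d e f → shift d (shift e f) ≗ shift (d + e) f
shift-shift zero    e f n       = refl
shift-shift (suc d) e f zero    = refl
shift-shift (suc d) e f (suc n) = shift-shift d e f n

shift-comm : ∀ d e f → shift d (shift e f) ≗ shift e (shift d f)
shift-comm d e f n = begin
  shift d (shift e f) n ≡⟨ shift-shift d e f n ⟩
  shift (d + e) f n     ≡⟨ cong (λ k → shift k f n) (+-comm d e) ⟩
  shift (e + d) f n     ≡⟨ shift-shift e d f n ⟨
  shift e (shift d f) n ∎

shift-offset : ∀ d e f n → shift (d + e) f (d + n) ≡ shift e f n
shift-offset zero    e f n = refl
shift-offset (suc d) e f n = shift-offset d e f n

-- The shift is by at least one, so the recurrence expresses each value through strictly smaller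
-- arguments. In generating functions, both series equal that of `h` divided by 1 - q ^ (d + 1).
shift-unique : ∀ d {f g h : ℕ → ℕ} →
  (∀ n → f n ≡ h n + shift (suc d) f n) →
  (∀ n → g n ≡ h n + shift (suc d) g n) →
  f ≗ g
shift-unique d {f} {g} {h} f-rec g-rec = <-rec (λ n → f n ≡ g n) step
  where
  below : ∀ n → (∀ {m} → m < n → f m ≡ g m) → shift (suc d) f n ≡ shift (suc d) g n
  below zero    ih = refl
  below (suc n) ih = shift-cong-≤ d n (ih ∘ s≤s)

  step : ∀ n → (∀ {m} → m < n → f m ≡ g m) → f n ≡ g n
  step n ih = begin
    f n                       ≡⟨ f-rec n ⟩
    h n + shift (suc d) f n   ≡⟨ cong (h n +_) (below n ih) ⟩
    h n + shift (suc d) g n   ≡⟨ g-rec n ⟨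
    g n                       ∎

-- Turns vanishing initial values and a step by `d` into the form that `shift-unique` expects, with
-- `shift d h` as the inhomogeneous term.
shift-intro : ∀ d f h → (∀ {n} → n < d → f n ≡ 0) → (∀ n → f (d + n) ≡ h n + f n) →
  ∀ n → f n ≡ shift d h n + shift d f n
shift-intro d f h f-< f-+ n with d ≤? n
... | yes d≤n = begin
  f n                           ≡⟨ cong f (m+[n∸m]≡n d≤n) ⟨
  f (d + (n ∸ d))               ≡⟨ f-+ (n ∸ d) ⟩
  h (n ∸ d) + f (n ∸ d)         ≡⟨ cong₂ _+_ (shift-≤ h d≤n) (shift-≤ f d≤n) ⟨
  shift d h n + shift d f n     ∎
... | no d≰n = begin
  f n                           ≡⟨ f-< n<d ⟩
  0                             ≡⟨ cong₂ _+_ (shift-< h n<d) (shift-< f n<d) ⟨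
  shift d h n + shift d f n     ∎
  where n<d = ≰⇒> d≰n

-- Finite sums

sum-map-+ : ∀ (f g : A → ℕ) xs →
  sum (map (λ x → f x + g x) xs) ≡ sum (map f xs) + sum (map g xs)
sum-map-+ f g []       = refl
sum-map-+ f g (x ∷ xs) = begin
  f x + g x + sum (map (λ y → f y + g y) xs)       ≡⟨ cong (f x + g x +_) (sum-map-+ f g xs) ⟩
  f x + g x + (sum (map f xs) + sum (map g xs))    ≡⟨ interchange +-commutativeSemigroup (f x) _ _ _ ⟩
  f x + sum (map f xs) + (g x + sum (map g xs))    ∎

sum-map-0 : ∀ (xs : List A) → sum (map (λ _ → 0) xs) ≡ 0
sum-map-0 []       = refl
sum-map-0 (x ∷ xs) = sum-map-0 xs

sum-map-1 : ∀ (xs : List A) → sum (map (λ _ → 1) xs) ≡ length xs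
sum-map-1 []       = refl
sum-map-1 (x ∷ xs) = cong suc (sum-map-1 xs)

sum-map-applyUpTo : ∀ (f : ℕ → A → ℕ) N xs →
  sum (map (λ x → sum (applyUpTo (λ i → f i x) N)) xs) ≡
  sum (applyUpTo (λ i → sum (map (f i) xs)) N)
sum-map-applyUpTo f zero    xs = sum-map-0 xs
sum-map-applyUpTo f (suc N) xs = begin
  sum (map (λ x → f 0 x + sum (applyUpTo (λ i → f (suc i) x) N)) xs)
    ≡⟨ sum-map-+ (f 0) _ xs ⟩
  sum (map (f 0) xs) + sum (map (λ x → sum (applyUpTo (λ i → f (suc i) x) N)) xs)
    ≡⟨ cong (sum (map (f 0) xs) +_) (sum-map-applyUpTo (f ∘ suc) N xs) ⟩
  sum (map (f 0) xs) + sum (applyUpTo (λ i → sum (map (f (suc i)) xs)) N) ∎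

length-filter-sum : ∀ {P : A → Set} (P? : Decidable P) xs →
  length (filter P? xs) ≡ sum (map (λ x → if does (P? x) then 1 else 0) xs)
length-filter-sum P? []       = refl
length-filter-sum P? (x ∷ xs) with does (P? x)
... | true  = cong suc (length-filter-sum P? xs)
... | false = length-filter-sum P? xs

sum-applyUpTo-cong : ∀ {f g} N → f ≗ g → sum (applyUpTo f N) ≡ sum (applyUpTo g N)
sum-applyUpTo-cong zero    f≗g = refl
sum-applyUpTo-cong (suc N) f≗g = cong₂ _+_ (f≗g 0) (sum-applyUpTo-cong N (f≗g ∘ suc))

sum-applyUpTo-0 : ∀ {f} N → (∀ {i} → i < N → f i ≡ 0) → sum (applyUpTo f N) ≡ 0
sum-applyUpTo-0 zero    f≡0 = refl
sum-applyUpTo-0 (suc N) f≡0 = cong₂ _+_ (f≡0 z<s) (sum-applyUpTo-0 N (f≡0 ∘ s<s))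

-- Both sides sum `f` over 0, ..., N, with the first terms grouped differently; this is the
-- telescoping step for `Q-progression`.
sum-applyUpTo-suc : ∀ f N → f 0 + sum (applyUpTo (f ∘ suc) N) ≡ f N + sum (applyUpTo f N)
sum-applyUpTo-suc f zero    = refl
sum-applyUpTo-suc f (suc N) = begin
  f 0 + (f 1 + sum (applyUpTo (f ∘ suc ∘ suc) N))    ≡⟨ cong (f 0 +_) (sum-applyUpTo-suc (f ∘ suc) N) ⟩
  f 0 + (f (suc N) + sum (applyUpTo (f ∘ suc) N))    ≡⟨ x∙yz≈y∙xz +-commutativeSemigroup (f 0) (f (suc N)) _ ⟩
  f (suc N) + (f 0 + sum (applyUpTo (f ∘ suc) N))    ∎

-- Sums over partitions with bounded parts

-- After a part is removed, the recursion may hold more fuel than the amount `b + m` that `total`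
-- fixes; this lemma reconciles the two.
partitionsUpTo-fuel : ∀ f g b m → b + m ≤ f → b + m ≤ g →
  partitionsUpTo f b m ≡ partitionsUpTo g b m
partitionsUpTo-fuel f       g       b       zero    _   _   = refl
partitionsUpTo-fuel f       g       zero    (suc m) _   _   = refl
partitionsUpTo-fuel (suc f) (suc g) (suc b) (suc m) ≤f ≤g =
  cong₂ _++_ with-part (partitionsUpTo-fuel f g b (suc m) (s≤s⁻¹ ≤f) (s≤s⁻¹ ≤g))
  where
  fuel : ∀ {h} → b ≤ m → suc b + suc m ≤ suc h → suc b + (m ∸ b) ≤ h
  fuel b≤m ≤h = ≤-trans (≤-reflexive (cong suc (m+[n∸m]≡n b≤m)))
                        (≤-trans (m≤n+m (suc m) b) (s≤s⁻¹ ≤h))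

  with-part :
    (if suc b ≤ᵇ suc m then map (suc b ∷_) (partitionsUpTo f (suc b) (m ∸ b)) else []) ≡
    (if suc b ≤ᵇ suc m then map (suc b ∷_) (partitionsUpTo g (suc b) (m ∸ b)) else [])
  with-part with suc b ≤ᵇ suc m | ≤ᵇ-reflects-≤ (suc b) (suc m)
  ... | false | _       = refl
  ... | true  | ofʸ b≤m = cong (map (suc b ∷_))
    (partitionsUpTo-fuel f g (suc b) (m ∸ b) (fuel (s≤s⁻¹ b≤m) ≤f) (fuel (s≤s⁻¹ b≤m) ≤g))

-- The sum of φ over the partitions of n with all parts ≤ b.
total : (List ℕ → ℕ) → ℕ → ℕ → ℕ
total φ b n = sum (map φ (partitionsUpTo (b + n) b n))

total-cong : ∀ {φ ψ} → φ ≗ ψ → ∀ b → total φ b ≗ total ψ b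
total-cong φ≗ψ b n = cong sum (map-cong φ≗ψ (partitionsUpTo (b + n) b n))

-- Split by whether the part `suc b` occurs. Removing one copy leaves parts still bounded by
-- `suc b`, so the same bound returns under the shift, and `φ` is evaluated with the copy put back.
total-suc : ∀ φ b n →
  total φ (suc b) n ≡ total φ b n + shift (suc b) (total (φ ∘ (suc b ∷_)) (suc b)) n
total-suc φ b zero    = sym (+-identityʳ _)
total-suc φ b (suc n) = begin
  sum (map φ (with-part ++ without))             ≡⟨ cong sum (map-++ φ with-part without) ⟩
  sum (map φ with-part ++ map φ without)         ≡⟨ sum-++ (map φ with-part) (map φ without) ⟩
  sum (map φ with-part) + sum (map φ without)    ≡⟨ +-comm (sum (map φ with-part)) _ ⟩
  sum (map φ without) + sum (map φ with-part)    ≡⟨ cong (sum (map φ without) +_) shifted ⟩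
  total φ b (suc n) + shift (suc b) (total (φ ∘ (suc b ∷_)) (suc b)) (suc n) ∎
  where
  without   = partitionsUpTo (b + suc n) b (suc n)
  with-part = if suc b ≤ᵇ suc n
              then map (suc b ∷_) (partitionsUpTo (b + suc n) (suc b) (n ∸ b)) else []

  shifted : sum (map φ with-part) ≡ shift b (total (φ ∘ (suc b ∷_)) (suc b)) n
  shifted with suc b ≤ᵇ suc n | ≤ᵇ-reflects-≤ (suc b) (suc n)
  ... | false | ofⁿ b≰n = sym (shift-< _ (s<s⁻¹ (≰⇒> b≰n)))
  ... | true  | ofʸ b≤n = begin
    sum (map φ (map (suc b ∷_) (partitionsUpTo (b + suc n) (suc b) (n ∸ b))))
      ≡⟨ cong sum (map-∘ (partitionsUpTo (b + suc n) (suc b) (n ∸ b))) ⟨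
    sum (map (φ ∘ (suc b ∷_)) (partitionsUpTo (b + suc n) (suc b) (n ∸ b)))
      ≡⟨ cong (sum ∘ map _) (partitionsUpTo-fuel _ _ (suc b) (n ∸ b) fuel ≤-refl) ⟩
    total (φ ∘ (suc b ∷_)) (suc b) (n ∸ b)
      ≡⟨ shift-≤ _ (s≤s⁻¹ b≤n) ⟨
    shift b (total (φ ∘ (suc b ∷_)) (suc b)) n ∎
    where
    fuel : suc b + (n ∸ b) ≤ b + suc n
    fuel = ≤-trans (≤-reflexive (cong suc (m+[n∸m]≡n (s≤s⁻¹ b≤n)))) (m≤n+m (suc n) b)

-- `partitions n` is the case of bound `n`; raising the bound further only admits parts larger than
-- `n`, which cannot occur.
total-partitions′ : ∀ φ {b n} → n ≤′ b → total φ b n ≡ sum (map φ (partitions n))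
total-partitions′ φ ≤′-refl = refl
total-partitions′ φ {suc b} {n} (≤′-step n≤b) = begin
  total φ (suc b) n                                              ≡⟨ total-suc φ b n ⟩
  total φ b n + shift (suc b) (total (φ ∘ (suc b ∷_)) (suc b)) n ≡⟨ cong (total φ b n +_) (shift-< _ (s≤s (≤′⇒≤ n≤b))) ⟩
  total φ b n + 0                                                ≡⟨ +-identityʳ _ ⟩
  total φ b n                                                    ≡⟨ total-partitions′ φ n≤b ⟩
  sum (map φ (partitions n))                                     ∎

total-partitions : ∀ φ {b n} → n ≤ b → total φ b n ≡ sum (map φ (partitions n))
total-partitions φ = total-partitions′ φ ∘ ≤⇒≤′

-- Deleting copies of a fixed part

multiplicity-∷-≡ : ∀ j π → multiplicity j (j ∷ π) ≡ suc (multiplicity j π)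
multiplicity-∷-≡ j π = cong length (filter-accept (j ≟_) {j} {π} refl)

multiplicity-∷-≢ : ∀ {j x} → j ≢ x → ∀ π → multiplicity j (x ∷ π) ≡ multiplicity j π
multiplicity-∷-≢ {j} j≢x π = cong length (filter-reject (j ≟_) {xs = π} j≢x)

-- The part `suc b` differs from `j`, so putting it back does not change the multiplicity of `j`.
-- The recurrence thus closes on a single function, as `shift-unique` requires.
total-multiplicity-suc : ∀ {j b} (g : ℕ → ℕ) → j < suc b → ∀ n →
  total (g ∘ multiplicity j) (suc b) n ≡
  total (g ∘ multiplicity j) b n + shift (suc b) (total (g ∘ multiplicity j) (suc b)) n
total-multiplicity-suc {j} {b} g j<1+b n = trans (total-suc _ b n)
  (cong (total (g ∘ multiplicity j) b n +_)
    (shift-cong (suc b) (total-cong (cong g ∘ multiplicity-∷-≢ (<⇒≢ j<1+b)) (suc b)) n))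

-- No part reaches `j`, so its multiplicity is 0 throughout. The lists are not inspected: both sides
-- satisfy the same recurrence at each bound.
total-multiplicity-> : ∀ {j} b (g : ℕ → ℕ) → b < j →
  total (g ∘ multiplicity j) b ≗ total (λ _ → g 0) b
total-multiplicity-> zero g b<j zero    = refl
total-multiplicity-> zero g b<j (suc n) = refl
total-multiplicity-> {j} (suc b) g b<j = shift-unique b lhs-rec (total-suc (λ _ → g 0) b)
  where
  lhs-rec : ∀ n → total (g ∘ multiplicity j) (suc b) n ≡
    total (λ _ → g 0) b n + shift (suc b) (total (g ∘ multiplicity j) (suc b)) n
  lhs-rec n = trans (total-suc _ b n)
    (cong₂ _+_ (total-multiplicity-> b g (<-trans (n<1+n b) b<j) n)
      (shift-cong (suc b) (total-cong (cong g ∘ multiplicity-∷-≢ (>⇒≢ b<j)) (suc b)) n))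

-- Deleting one part suc j; the hypothesis g 0 ≡ 0 discards the partitions
-- that have no such part.
total-multiplicity : ∀ j {b} (g : ℕ → ℕ) → g 0 ≡ 0 → suc j ≤′ b →
  total (g ∘ multiplicity (suc j)) b ≗ shift (suc j) (total (g ∘ suc ∘ multiplicity (suc j)) b)
-- At bound `suc j` the deleted part is the largest allowed, so `total-suc` performs the deletion
-- itself.
total-multiplicity j g g0≡0 ≤′-refl n = begin
  total (g ∘ multiplicity (suc j)) (suc j) n
    ≡⟨ total-suc _ j n ⟩
  total (g ∘ multiplicity (suc j)) j n + shift (suc j) (total (λ π → g (multiplicity (suc j) (suc j ∷ π))) (suc j)) n
    ≡⟨ cong₂ _+_ absent (shift-cong (suc j) (total-cong (cong g ∘ multiplicity-∷-≡ (suc j)) (suc j)) n) ⟩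
  shift (suc j) (total (g ∘ suc ∘ multiplicity (suc j)) (suc j)) n ∎
  where
  absent : total (g ∘ multiplicity (suc j)) j n ≡ 0
  absent = begin
    total (g ∘ multiplicity (suc j)) j n ≡⟨ total-multiplicity-> j g ≤-refl n ⟩
    total (λ _ → g 0) j n                ≡⟨ total-cong (λ _ → g0≡0) j n ⟩
    total (λ _ → 0) j n                  ≡⟨ sum-map-0 (partitionsUpTo (j + n) j n) ⟩
    0                                    ∎
total-multiplicity j {suc b} g g0≡0 (≤′-step j<b) =
  -- For a larger bound both sides obey the recurrence for the part `suc b`; the induction
  -- hypothesis matches the inhomogeneous terms, and the two shifts commute.
  shift-unique b (total-multiplicity-suc g 1+j<1+b) rhs-rec
  where
  1+j<1+b = s≤s (≤′⇒≤ j<b)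
  F       = total (g ∘ suc ∘ multiplicity (suc j))

  rhs-rec : ∀ n → shift (suc j) (F (suc b)) n ≡
    total (g ∘ multiplicity (suc j)) b n + shift (suc b) (shift (suc j) (F (suc b))) n
  rhs-rec n = begin
    shift (suc j) (F (suc b)) n
      ≡⟨ shift-cong (suc j) (total-multiplicity-suc (g ∘ suc) 1+j<1+b) n ⟩
    shift (suc j) (λ m → F b m + shift (suc b) (F (suc b)) m) n
      ≡⟨ shift-+ (suc j) _ _ n ⟩
    shift (suc j) (F b) n + shift (suc j) (shift (suc b) (F (suc b))) n
      ≡⟨ cong₂ _+_ (sym (total-multiplicity j g g0≡0 j<b n)) (shift-comm (suc j) (suc b) (F (suc b)) n) ⟩
    total (g ∘ multiplicity (suc j)) b n + shift (suc b) (shift (suc j) (F (suc b))) n ∎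

-- Recurrence for `Q`

p : ℕ → ℕ
p = length ∘ partitions

-- `total-multiplicity` with `g` the identity: the deleted copy adds 1 to the remaining
-- multiplicity, and these ones sum to `p m`.
Q-rec : ∀ j n → Q (suc j) n ≡ shift (suc j) (λ m → p m + Q (suc j) m) n
Q-rec j n = begin
  Q (suc j) n
    ≡⟨ total-partitions _ n≤b ⟨
  total (multiplicity (suc j)) b n
    ≡⟨ total-multiplicity j (λ m → m) refl (≤⇒≤′ (m≤m+n (suc j) n)) n ⟩
  shift (suc j) (total (suc ∘ multiplicity (suc j)) b) n
    ≡⟨ shift-cong-≤ (suc j) n split ⟩
  shift (suc j) (λ m → p m + Q (suc j) m) n ∎
  where
  -- Large enough both for all partitions of numbers up to `n` and for `suc j` to be an admissible
  -- part.
  b   = suc j + n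
  n≤b = m≤n+m n (suc j)

  split : ∀ {m} → m ≤ n → total (suc ∘ multiplicity (suc j)) b m ≡ p m + Q (suc j) m
  split {m} m≤n = begin
    total (suc ∘ multiplicity (suc j)) b m
      ≡⟨ total-partitions _ (≤-trans m≤n n≤b) ⟩
    sum (map (suc ∘ multiplicity (suc j)) (partitions m))
      ≡⟨ sum-map-+ (λ _ → 1) (multiplicity (suc j)) (partitions m) ⟩
    sum (map (λ _ → 1) (partitions m)) + Q (suc j) m
      ≡⟨ cong (_+ Q (suc j) m) (sum-map-1 (partitions m)) ⟩
    p m + Q (suc j) m ∎

Q-< : ∀ j .{{_ : NonZero j}} {n} → n < j → Q j n ≡ 0
Q-< (suc j) {n} n<j = trans (Q-rec j n) (shift-< _ n<j)

Q-+ : ∀ j .{{_ : NonZero j}} n → Q j (j + n) ≡ p n + Q j n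
Q-+ (suc j) n = begin
  Q (suc j) (suc j + n)                                   ≡⟨ Q-rec j (suc j + n) ⟩
  shift (suc j) (λ m → p m + Q (suc j) m) (suc j + n)     ≡⟨ shift-≤ _ (m≤m+n (suc j) n) ⟩
  p (suc j + n ∸ suc j) + Q (suc j) (suc j + n ∸ suc j)   ≡⟨ cong (λ m → p m + Q (suc j) m) (m+n∸m≡n (suc j) n) ⟩
  p n + Q (suc j) n                                       ∎

-- Partitions with at least `t` copies of a part

-- The Boolean test agrees by computation with the decision `k ≤? multiplicity j π` in
-- `distinctPartsOccurring≥`.
atLeast : ℕ → ℕ → ℕ
atLeast t m = if t ≤ᵇ m then 1 else 0

atLeast-suc : ∀ t → atLeast (suc t) ∘ suc ≗ atLeast t
atLeast-suc zero    m = refl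
atLeast-suc (suc t) m = refl

-- Each deleted copy lowers the threshold by one and shifts by `suc j`; at threshold 0 the indicator
-- is constantly 1.
total-atLeast : ∀ t j {b} → suc j ≤′ b →
  total (atLeast t ∘ multiplicity (suc j)) b ≗ shift (t * suc j) (total (λ _ → 1) b)
total-atLeast zero    j     j<b n = refl
total-atLeast (suc t) j {b} j<b n = begin
  total (atLeast (suc t) ∘ multiplicity (suc j)) b n
    ≡⟨ total-multiplicity j (atLeast (suc t)) refl j<b n ⟩
  shift (suc j) (total (atLeast (suc t) ∘ suc ∘ multiplicity (suc j)) b) n
    ≡⟨ shift-cong (suc j) (total-cong (atLeast-suc t ∘ multiplicity (suc j)) b) n ⟩
  shift (suc j) (total (atLeast t ∘ multiplicity (suc j)) b) n
    ≡⟨ shift-cong (suc j) (total-atLeast t j j<b) n ⟩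
  shift (suc j) (shift (t * suc j) (total (λ _ → 1) b)) n
    ≡⟨ shift-shift (suc j) (t * suc j) _ n ⟩
  shift (suc t * suc j) (total (λ _ → 1) b) n ∎

partitions-atLeast : ∀ t j n →
  sum (map (atLeast t ∘ multiplicity (suc j)) (partitions n)) ≡ shift (t * suc j) p n
partitions-atLeast t j n = begin
  sum (map (atLeast t ∘ multiplicity (suc j)) (partitions n))
    ≡⟨ total-partitions _ n≤b ⟨
  total (atLeast t ∘ multiplicity (suc j)) b n
    ≡⟨ total-atLeast t j (≤⇒≤′ (m≤m+n (suc j) n)) n ⟩
  shift (t * suc j) (total (λ _ → 1) b) n
    ≡⟨ shift-cong-≤ (t * suc j) n (λ {m} m≤n →
         trans (total-partitions _ (≤-trans m≤n n≤b)) (sum-map-1 (partitions m))) ⟩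
  shift (t * suc j) p n ∎
  where
  b   = suc j + n
  n≤b = m≤n+m n (suc j)

-- Recurrence for `V`

∈⇒≤sum : ∀ {j π} → j ∈ π → j ≤ sum π
∈⇒≤sum {π = x ∷ π} (here refl)  = m≤m+n x (sum π)
∈⇒≤sum {π = x ∷ π} (there j∈π) = ≤-trans (∈⇒≤sum j∈π) (m≤n+m (sum π) x)

multiplicity>0⇒∈ : ∀ {j} π → 0 < multiplicity j π → j ∈ π
multiplicity>0⇒∈ {j} (x ∷ π) 0<mult with j ≟ x
... | yes j≡x = here j≡x
... | no  j≢x = there (multiplicity>0⇒∈ π (subst (0 <_) (multiplicity-∷-≢ j≢x π) 0<mult))

-- The frequent parts can be selected from the deduplicated partition or from 1, ..., N. Both
-- selections are free of repetitions and have the same members, hence the same length.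
distinctPartsOccurring≥-sum : ∀ k .{{_ : NonZero k}} {N n π} → n ≤ N → IsPartition n π →
  distinctPartsOccurring≥ k π ≡ sum (applyUpTo (λ i → atLeast k (multiplicity (suc i) π)) N)
distinctPartsOccurring≥-sum k@(suc _) {N} {n} {π} n≤N (record { positive = pos ; sum≡ = refl }) = begin
  length (filter often? (deduplicate _≟_ π))
    ≡⟨ ↭-length (∼bag⇒↭ (unique∧set⇒bag
         (filter⁺ often? (deduplicate-! _≟_ π))
         (filter⁺ often? (applyUpTo⁺₁ suc N (λ i<j _ → <⇒≢ i<j ∘ suc-injective)))
         (mk⇔ to from))) ⟩
  length (filter often? (applyUpTo suc N))
    ≡⟨ length-filter-sum often? (applyUpTo suc N) ⟩
  sum (map (λ j → atLeast k (multiplicity j π)) (applyUpTo suc N))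
    ≡⟨ cong sum (map-applyUpTo suc _ N) ⟩
  sum (applyUpTo (λ i → atLeast k (multiplicity (suc i) π)) N) ∎
  where
  often? : Decidable (λ j → k ≤ multiplicity j π)
  often? j = k ≤? multiplicity j π

  ∈-range : ∀ {j} → 0 < j → j ≤ N → j ∈ applyUpTo suc N
  ∈-range {suc i} _ i<N = ∈-applyUpTo⁺ suc i<N

  to : ∀ {j} → j ∈ filter often? (deduplicate _≟_ π) → j ∈ filter often? (applyUpTo suc N)
  to j∈ with j∈dedup , often ← ∈-filter⁻ often? j∈ =
    let j∈π = ∈-deduplicate⁻ _≟_ π j∈dedup in
    ∈-filter⁺ often? (∈-range (lookup pos j∈π) (≤-trans (∈⇒≤sum j∈π) n≤N)) often

  from : ∀ {j} → j ∈ filter often? (applyUpTo suc N) → j ∈ filter often? (deduplicate _≟_ π)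
  from j∈ with _ , often ← ∈-filter⁻ often? {xs = applyUpTo suc N} j∈ =
    -- Since `k` is positive, a number occurring `k` times does occur in `π`.
    ∈-filter⁺ often? (∈-deduplicate⁺ _≟_ (multiplicity>0⇒∈ π (<-≤-trans z<s often))) often

-- Exchange the sums over partitions and over parts: the part `suc i` contributes the number of
-- partitions containing it at least `k` times. Any bound `N` from `n` on will do, a freedom that
-- `V-+` exploits.
V-sum : ∀ k .{{_ : NonZero k}} {N n} → n ≤ N →
  V k n ≡ sum (applyUpTo (λ i → shift (k * suc i) p n) N)
V-sum k {N} {n} n≤N = begin
  V k n
    ≡⟨ cong sum (map-cong-local (tabulate λ π∈ →
         distinctPartsOccurring≥-sum k n≤N (Equivalence.to (∈-partitions⇔ n) π∈))) ⟩
  sum (map (λ π → sum (applyUpTo (λ i → atLeast k (multiplicity (suc i) π)) N)) (partitions n))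
    ≡⟨ sum-map-applyUpTo (λ i → atLeast k ∘ multiplicity (suc i)) N (partitions n) ⟩
  sum (applyUpTo (λ i → sum (map (atLeast k ∘ multiplicity (suc i)) (partitions n))) N)
    ≡⟨ sum-applyUpTo-cong N (λ i → partitions-atLeast k i n) ⟩
  sum (applyUpTo (λ i → shift (k * suc i) p n) N) ∎

V-< : ∀ k .{{_ : NonZero k}} {n} → n < k → V k n ≡ 0
V-< k {n} n<k = trans (V-sum k {n} ≤-refl)
  (sum-applyUpTo-0 n (λ {i} _ → shift-< p (<-≤-trans n<k (m≤m*n k (suc i)))))

V-+ : ∀ k .{{_ : NonZero k}} n → V k (k + n) ≡ p n + V k n
V-+ k@(suc k-1) n = begin
  V k (k + n)
    ≡⟨ V-sum k ≤-refl ⟩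
  -- As `k + n` is `suc (k-1 + n)`, the first term splits off. Lowering every shift by `k` turns it
  -- into `p n` and the rest into `V-sum` for `n` with bound `k-1 + n`.
  shift (k * 1) p (k + n) + sum (applyUpTo (λ i → shift (k * suc (suc i)) p (k + n)) (k-1 + n))
    ≡⟨ cong₂ _+_ (offset 0) (sum-applyUpTo-cong (k-1 + n) (offset ∘ suc)) ⟩
  shift (k * 0) p n + sum (applyUpTo (λ i → shift (k * suc i) p n) (k-1 + n))
    ≡⟨ cong₂ _+_ (cong (λ d → shift d p n) (*-zeroʳ k)) (sym (V-sum k (m≤n+m n k-1))) ⟩
  p n + V k n ∎
  where
  offset : ∀ i → shift (k * suc i) p (k + n) ≡ shift (k * i) p n
  offset i = trans (cong (λ d → shift d p (k + n)) (*-suc k i)) (shift-offset k (k * i) p n)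

-- Sums of `Q` along a progression, and the comparison with `V`

Q-progression : (k r n : ℕ) → ℕ
Q-progression k r n = sum (applyUpTo (λ i → Q (r * k) (n + i * k)) r)

Q-progression-< : ∀ k r .{{_ : NonZero k}} .{{_ : NonZero r}} {n} → n < k →
  Q-progression k r n ≡ 0
Q-progression-< k r {n} n<k = sum-applyUpTo-0 r λ {i} i<r →
  -- Here n + i k < (i + 1) k ≤ r k, so the part `r * k` is too large to occur.
  Q-< (r * k) {{m*n≢0 r k}} (<-≤-trans (+-monoˡ-< (i * k) n<k) (*-monoˡ-≤ k i<r))

-- Adding `k` to `n` moves each term to the next one, so `q 0` is lost and `q r` gained, and `Q-+`
-- gives their difference as `p n`. Adding `q 0` to both sides avoids subtraction.
Q-progression-+ : ∀ k r .{{_ : NonZero k}} .{{_ : NonZero r}} n →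
  Q-progression k r (k + n) ≡ p n + Q-progression k r n
Q-progression-+ k r n = +-cancelˡ-≡ (q 0) _ _ (begin
  q 0 + Q-progression k r (k + n)
    ≡⟨ cong (q 0 +_) (sum-applyUpTo-cong r λ i → cong (Q (r * k)) (reassoc (i * k))) ⟩
  q 0 + sum (applyUpTo (q ∘ suc) r)
    ≡⟨ sum-applyUpTo-suc q r ⟩
  q r + Q-progression k r n
    ≡⟨ cong (_+ Q-progression k r n) q-r ⟩
  q 0 + p n + Q-progression k r n
    ≡⟨ +-assoc (q 0) _ _ ⟩
  q 0 + (p n + Q-progression k r n) ∎)
  where
  q : ℕ → ℕ
  q i = Q (r * k) (n + i * k)

  reassoc : ∀ m → k + n + m ≡ n + (k + m)
  reassoc m = trans (cong (_+ m) (+-comm k n)) (+-assoc n k m)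

  q-r : q r ≡ q 0 + p n
  q-r = begin
    Q (r * k) (n + r * k)         ≡⟨ cong (Q (r * k)) (+-comm n (r * k)) ⟩
    Q (r * k) (r * k + n)         ≡⟨ Q-+ (r * k) {{m*n≢0 r k}} n ⟩
    p n + Q (r * k) n             ≡⟨ +-comm (p n) _ ⟩
    Q (r * k) n + p n             ≡⟨ cong (λ m → Q (r * k) m + p n) (+-identityʳ n) ⟨
    Q (r * k) (n + 0) + p n       ∎

V≗Q-progression : ∀ k r .{{_ : NonZero k}} .{{_ : NonZero r}} → V k ≗ Q-progression k r
V≗Q-progression k@(suc k-1) r = shift-unique k-1
  (shift-intro k (V k) p (V-< k) (V-+ k))
  (shift-intro k (Q-progression k r) p (Q-progression-< k r) (Q-progression-+ k r))

theorem2 : (n k r : ℕ) → .{{NonZero n}} → .{{NonZero k}} → .{{NonZero r}} →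
    V k n ≡ sum (map (λ i → Q (r * k) (n + i * k)) (upTo r))
theorem2 n k r = trans (V≗Q-progression k r n) (cong sum (sym (map-upTo _ r)))
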